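{- If $G$ is a chordal graph, then its injective hull $\mathcal{H}(G)$ is also chordal.
   Context: Graphs are finite, connected, simple, with shortest-path metric. A graph is chordal if it has no induced cycle of length at least 4. A graph is Helly if every family of pairwise intersecting disks $D(v,r)=\{u:d(u,v)\le r\}$ has a common vertex. The injective hull $\mathcal{H}(G)$ is the unique minimal Helly graph containing $G$ as an isometric subgraph (equivalently, the graph on functions $f:V(G)\to\mathbb{Z}_{\ge0}$ with $f(x)+f(y)\ge d_G(x,y)$ for all $x,y$ and for each $x$ some $y$ with equality, adjacency meaning sup-norm distance 1). -}

module Defs where

open import Level using (0ℓ)
open import Data.Nat using (ℕ; zero; suc; _+_; _≤_; _⊔_; ∣_-_∣)
open import Data.Fin using (Fin; toℕ)
open import Data.List using (List; foldr; map; allFin)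
open import Data.Product using (Σ; ∃; ∃-syntax; _×_; _,_; proj₁)
open import Data.Sum using (_⊎_)
open import Relation.Nullary using (¬_)
open import Relation.Binary.PropositionalEquality using (_≡_)

CycAdj : (k : ℕ) → Fin k → Fin k → Set
CycAdj k i j =
  (suc (toℕ i) ≡ toℕ j) ⊎ (suc (toℕ j) ≡ toℕ i)
  ⊎ ((toℕ i ≡ 0) × (suc (toℕ j) ≡ k))
  ⊎ ((toℕ j ≡ 0) × (suc (toℕ i) ≡ k))

record IsInducedCycle {V : Set} (_≈_ : V → V → Set) (_~_ : V → V → Set)
                      (k : ℕ) (v : Fin k → V) : Set where
  field
    distinct    : ∀ i j → ¬ (i ≡ j) → ¬ (v i ≈ v j)
    edges       : ∀ i j → CycAdj k i j → v i ~ v j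
    noChords    : ∀ i j → ¬ (i ≡ j) → ¬ CycAdj k i j → ¬ (v i ~ v j)

Chordal : {V : Set} → (V → V → Set) → (V → V → Set) → Set
Chordal {V} _≈_ _~_ =
  ∀ (k : ℕ) → 4 ≤ k → (v : Fin k → V) → ¬ IsInducedCycle _≈_ _~_ k v

data Walk {n : ℕ} (Adj : Fin n → Fin n → Set) : Fin n → Fin n → ℕ → Set where
  here : ∀ {x} → Walk Adj x x 0
  step : ∀ {x y z k} → Adj x y → Walk Adj y z k → Walk Adj x z (suc k)

record Graph : Set₁ where
  field
    n         : ℕ
    Adj       : Fin n → Fin n → Set
    sym       : ∀ {x y} → Adj x y → Adj y x
    irrefl    : ∀ {x} → ¬ Adj x x
    connected : ∀ x y → ∃[ k ] Walk Adj x y k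

  IsDist : Fin n → Fin n → ℕ → Set
  IsDist x y k = Walk Adj x y k × (∀ m → Walk Adj x y m → k ≤ m)

open Graph public

IsChordal : Graph → Set
IsChordal G = Chordal {Fin (n G)} _≡_ (Adj G)

module Hull (G : Graph) where

  V = Fin (n G)

  IsHullVertex : (V → ℕ) → Set
  IsHullVertex f =
    (∀ x y d → IsDist G x y d → d ≤ f x + f y)
    × (∀ x → ∃[ y ] ∃[ d ] (IsDist G x y d × (f x + f y ≡ d)))

  HVertex : Set
  HVertex = Σ (V → ℕ) IsHullVertex

  supDist : (V → ℕ) → (V → ℕ) → ℕ
  supDist f g = foldr _⊔_ 0 (map (λ x → ∣ f x - g x ∣) (allFin (n G)))

  _≈H_ : HVertex → HVertex → Set
  a ≈H b = ∀ x → proj₁ a x ≡ proj₁ b x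

  _~H_ : HVertex → HVertex → Set
  a ~H b = supDist (proj₁ a) (proj₁ b) ≡ 1

HullChordal : Graph → Set
HullChordal G = Chordal {Hull.HVertex G} (Hull._≈H_ G) (Hull._~H_ G)

{-# OPTIONS --safe #-}
module Submission where

-- Two hull functions f, g are equal or adjacent iff all disks D(x, f x) and
-- D(y, g y) are at distance at most 1 (Close).  Suppose f₀, …, f_k is an induced
-- cycle in the hull.  As f₀ and f₂ are not close, some disks A = D(x, f₀ x) and
-- B = D(y, f₂ y) are at distance at least 2.  Let C be the component containing B
-- of the complement of N[A].  Its boundary S is a clique, since two nonadjacent
-- vertices of S could be joined by shortest paths through A and through C, forming
-- a hole.  A disk that misses S lies inside C or outside C ∪ S, and disks of the
-- two kinds are never at distance at most 1.  Hence all disks of f₁ meet S, and,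
-- on the way from f₂ back to f₀ around the cycle, so do all disks of some f_j with
-- 3 ≤ j ≤ k.  As S is a clique, f₁ and f_j are close: a contradiction.
--
-- Adjacency need not be decidable; since the goal is ⊥, case distinctions are made
-- under double negation.

open import Defs

open import Data.Empty using (⊥; ⊥-elim)
open import Data.Nat
open import Data.Nat.Properties
open import Data.Nat.Induction using (<-wellFounded)
open import Induction.WellFounded using (Acc; acc)
open import Data.Fin using (Fin; toℕ; fromℕ<)
open import Data.Fin.Properties using (toℕ<n; toℕ-injective; toℕ-fromℕ<)
open import Data.List using (List; []; _∷_; foldr; map; allFin)
open import Data.List.Membership.Propositional using (_∈_)
open import Data.List.Membership.Propositional.Properties using (∈-allFin)
open import Data.List.Relation.Unary.Any using (here; there)
open import Data.Product using (∃; ∃-syntax; _×_; _,_; proj₁)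
open import Data.Sum using (_⊎_; inj₁; inj₂)
open import Function using (_∘_)
open import Relation.Nullary using (¬_; yes; no; contradiction)
open import Relation.Nullary.Decidable using (decidable-stable; ¬¬-excluded-middle)
open import Relation.Binary.Definitions using (tri<; tri≈; tri>)
open import Relation.Binary.PropositionalEquality
  using (_≡_; _≢_; refl; trans; cong; subst; subst₂)
  renaming (sym to ≡-sym)

-- Least witnesses under double negation

Least : (ℕ → Set) → ℕ → Set
Least P k = P k × (∀ m → P m → k ≤ m)

-- Without a least witness, well-founded induction refutes every `P k`, as a witness with none below
-- it would be least.
¬¬-least : (P : ℕ → Set) → ∃ P → ¬ ¬ ∃ (Least P)
¬¬-least P (k , pk) none = go k (<-wellFounded k) pk
  where
  go : ∀ k → Acc _<_ k → ¬ P k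
  go k (acc rec) pk = none (k , pk , λ m pm → ≮⇒≥ λ m<k → go m (rec m<k) pm)

-- Walks and shortest walks

module _ {n : ℕ} {R : Fin n → Fin n → Set} where

  -- Indices past the end stay at the last vertex, so `at` is total.
  at : ∀ {x y m} → Walk R x y m → ℕ → Fin n
  at {x} here       _       = x
  at {x} (step _ _) zero    = x
  at     (step _ w) (suc i) = at w i

  at-start : ∀ {x y m} (w : Walk R x y m) → at w 0 ≡ x
  at-start here       = refl
  at-start (step _ _) = refl

  at-end : ∀ {x y m} (w : Walk R x y m) → at w m ≡ y
  at-end here       = refl
  at-end (step _ w) = at-end w

  at-step : ∀ {x y m} (w : Walk R x y m) {i} → i < m → R (at w i) (at w (suc i))
  at-step (step e w) {zero}  _         = subst (R _) (≡-sym (at-start w)) e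
  at-step (step _ w) {suc i} (s≤s i<m) = at-step w i<m

  infixr 5 _++_
  _++_ : ∀ {x y z k l} → Walk R x y k → Walk R y z l → Walk R x z (k + l)
  here     ++ w′ = w′
  step e w ++ w′ = step e (w ++ w′)

  at-++ˡ : ∀ {x y z k l} (w : Walk R x y k) (w′ : Walk R y z l) {i} → i ≤ k →
           at (w ++ w′) i ≡ at w i
  at-++ˡ here       w′ z≤n       = at-start w′
  at-++ˡ (step _ _) w′ z≤n       = refl
  at-++ˡ (step _ w) w′ (s≤s i≤k) = at-++ˡ w w′ i≤k

  at-++ʳ : ∀ {x y z k l} (w : Walk R x y k) (w′ : Walk R y z l) i →
           at (w ++ w′) (k + i) ≡ at w′ i
  at-++ʳ here       w′ i = refl
  at-++ʳ (step _ w) w′ i = at-++ʳ w w′ i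

  snoc : ∀ {x y z k} → Walk R x y k → R y z → Walk R x z (suc k)
  snoc here       e′ = step e′ here
  snoc (step e w) e′ = step e (snoc w e′)

  reverse : (∀ {x y} → R x y → R y x) → ∀ {x y k} → Walk R x y k → Walk R y x k
  reverse R-sym here       = here
  reverse R-sym (step e w) = snoc (reverse R-sym w) (R-sym e)

  prefix : ∀ {x y m} (w : Walk R x y m) {i} → i ≤ m → Walk R x (at w i) i
  prefix here       z≤n       = here
  prefix (step _ _) z≤n       = here
  prefix (step e w) (s≤s i≤m) = step e (prefix w i≤m)

  suffix : ∀ {x y m} (w : Walk R x y m) i → Walk R (at w i) y (m ∸ i)
  suffix here       zero    = here
  suffix here       (suc i) = here
  suffix (step e w) zero    = step e w
  suffix (step e w) (suc i) = suffix w i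

  module _ {x y m} (w : Walk R x y m) (shortest : ∀ m′ → Walk R x y m′ → m ≤ m′) where

    -- Otherwise, cutting out the segment from `i` to `j` would give a shorter walk.
    shortest-distinct : ∀ {i j} → i < j → j ≤ m → at w i ≢ at w j
    shortest-distinct {i} {j} i<j j≤m eq = n≮n m (begin-strict
      m             ≤⟨ shortest _ (prefix w (≤-trans (<⇒≤ i<j) j≤m)
                         ++ subst (λ u → Walk R u y (m ∸ j)) (≡-sym eq) (suffix w j)) ⟩
      i + (m ∸ j)   <⟨ +-monoˡ-< (m ∸ j) i<j ⟩
      j + (m ∸ j)   ≡⟨ m+[n∸m]≡n j≤m ⟩
      m             ∎)
      where open ≤-Reasoning

    -- Replacing the segment from `i` to `j` by the edge gives a walk of length `i + 1 + (m ∸ j)`,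
    -- and minimality forces `j ≤ suc i`.
    shortest-chordless : ∀ {i j} → i < j → j ≤ m → R (at w i) (at w j) → j ≡ suc i
    shortest-chordless {i} {j} i<j j≤m e = ≤-antisym (+-cancelʳ-≤ (m ∸ j) j (suc i) (begin
      j + (m ∸ j)         ≡⟨ m+[n∸m]≡n j≤m ⟩
      m                   ≤⟨ shortest _ (prefix w (≤-trans (<⇒≤ i<j) j≤m) ++ step e (suffix w j)) ⟩
      i + suc (m ∸ j)     ≡⟨ +-suc i (m ∸ j) ⟩
      suc i + (m ∸ j)     ∎)) i<j
      where open ≤-Reasoning

mapWalk : ∀ {n} {R R′ : Fin n → Fin n → Set} → (∀ {x y} → R x y → R′ x y) →
          ∀ {x y k} → Walk R x y k → Walk R′ x y k
mapWalk h here       = here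
mapWalk h (step e w) = step (h e) (mapWalk h w)

at-mapWalk : ∀ {n} {R R′ : Fin n → Fin n → Set} (h : ∀ {x y} → R x y → R′ x y) →
             ∀ {x y k} (w : Walk R x y k) i → at (mapWalk {R′ = R′} h w) i ≡ at w i
at-mapWalk h here       i       = refl
at-mapWalk h (step _ _) zero    = refl
at-mapWalk h (step _ w) (suc i) = at-mapWalk h w i

-- Walks confined to a vertex set

module _ {n : ℕ} (R : Fin n → Fin n → Set) where

  Restrict : (Fin n → Set) → Fin n → Fin n → Set
  Restrict P x y = R x y × P x × P y

  at-Restrict : ∀ {P x y m} → P x → (w : Walk (Restrict P) x y m) → ∀ i → P (at w i)
  at-Restrict px here                    i       = px
  at-Restrict px (step _ _)              zero    = px
  at-Restrict px (step (_ , _ , px′) w) (suc i) = at-Restrict px′ w i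

Via : ∀ {n} → Fin n → Fin n → (Fin n → Set) → Fin n → Set
Via s t A u = u ≡ s ⊎ u ≡ t ⊎ A u

module _ (G : Graph) where

  private
    V = Fin (n G)
    E = Adj G

  -- Holes made of two shortest walks

  shortest-interior : ∀ {A : V → Set} {s t m} (w : Walk (Restrict E (Via s t A)) s t m) →
    (∀ m′ → Walk (Restrict E (Via s t A)) s t m′ → m ≤ m′) →
    ∀ {i} → 0 < i → i < m → A (at w i)
  shortest-interior w shortest {i} 0<i i<m with at-Restrict E (inj₁ refl) w i
  ... | inj₁ eq        = ⊥-elim (shortest-distinct w shortest 0<i (<⇒≤ i<m) (trans (at-start w) (≡-sym eq)))
  ... | inj₂ (inj₁ eq) = ⊥-elim (shortest-distinct w shortest i<m ≤-refl (trans eq (≡-sym (at-end w))))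
  ... | inj₂ (inj₂ a)  = a

  restricted-length≥2 : ∀ {P : V → Set} {s t m} → s ≢ t → ¬ E s t → Walk (Restrict E P) s t m → 2 ≤ m
  restricted-length≥2 s≢t _   here                         = contradiction refl s≢t
  restricted-length≥2 _   ¬st (step (e , _) here)          = contradiction e ¬st
  restricted-length≥2 _   _   (step _ (step _ _))          = s≤s (s≤s z≤n)

  -- Take both walks shortest in their allowed sets and glue them. Minimality excludes repetitions
  -- and chords within each walk, the hypotheses on `A` and `C` exclude them between the interiors,
  -- and each walk has at least two edges. The result is a hole.
  no-two-sided-detour : IsChordal G → (A C : V → Set) →
    (∀ {u c} → A u → C c → u ≢ c) → (∀ {u c} → A u → C c → ¬ E u c) →
    ∀ {s t k l} → s ≢ t → ¬ E s t →
    Walk (Restrict E (Via s t A)) s t k → Walk (Restrict E (Via t s C)) t s l → ⊥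
  no-two-sided-detour chordal A C disjoint separated {s} {t} s≢t ¬st p₀ q₀ =
    ¬¬-least _ (_ , p₀) λ (m , p , p-min) →
    ¬¬-least _ (_ , q₀) λ (l , q , q-min) →
    hole p p-min q q-min
    where
    hole : ∀ {m l} (p : Walk (Restrict E (Via s t A)) s t m) →
           (∀ m′ → Walk (Restrict E (Via s t A)) s t m′ → m ≤ m′) →
           (q : Walk (Restrict E (Via t s C)) t s l) →
           (∀ l′ → Walk (Restrict E (Via t s C)) t s l′ → l ≤ l′) → ⊥
    hole {m} {l} p p-min q q-min =
      chordal (m + l) (+-mono-≤ 2≤m 2≤l) (at w ∘ toℕ) record
        { distinct = λ i j i≢j → distinct i j i≢j (<-cmp (toℕ i) (toℕ j))
        ; edges    = edges
        ; noChords = λ i j i≢j ¬adj e → chords i j i≢j ¬adj e (<-cmp (toℕ i) (toℕ j))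
        }
      where
      2≤m = restricted-length≥2 s≢t ¬st p
      2≤l = restricted-length≥2 (s≢t ∘ ≡-sym) (¬st ∘ sym G) q

      w : Walk E s s (m + l)
      w = mapWalk proj₁ p ++ mapWalk proj₁ q

      at-p : ∀ {i} → i ≤ m → at w i ≡ at p i
      at-p i≤m = trans (at-++ˡ (mapWalk proj₁ p) (mapWalk proj₁ q) i≤m) (at-mapWalk proj₁ p _)

      at-q : ∀ i → at w (m + i) ≡ at q i
      at-q i = trans (at-++ʳ (mapWalk proj₁ p) (mapWalk proj₁ q) i) (at-mapWalk proj₁ q _)

      P-p : ∀ i → Via s t A (at p i)
      P-p = at-Restrict E (inj₁ refl) p

      Q-q : ∀ i → Via t s C (at q i)
      Q-q = at-Restrict E (inj₁ refl) q

      w-closed : at w (m + l) ≡ at w 0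
      w-closed = trans (at-end w) (≡-sym (at-start w))

      -- Index 0 is `s`, index `m` is `t`, and `m + l` is `s` again. Paired with a vertex of `q`,
      -- index 0 is read as the end of `q`, so that the closing edge becomes the last edge of `q`.
      data Position : ℕ → ℕ → Set where
        both-p   : ∀ {i j} → i < j → j ≤ m → Position i j
        both-q   : ∀ {i j} → i < j → j < l → Position (m + i) (m + j)
        start-q  : ∀ {j} → j < l → Position 0 (m + j)
        interior : ∀ {i j} → 0 < i → i < m → 0 < j → j < l → Position i (m + j)

      position : ∀ {i j} → i < j → j < m + l → Position i j
      position {i} {j} i<j j<m+l with ≤-<-connex j m
      ... | inj₁ j≤m = both-p i<j j≤m
      ... | inj₂ m<j = subst (Position i) (m+[n∸m]≡n (<⇒≤ m<j)) (beyond i i<j (≤-<-connex m i))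
        where
        j∸m<l : j ∸ m < l
        j∸m<l = subst (j ∸ m <_) (m+n∸m≡n m l) (∸-monoˡ-< j<m+l (<⇒≤ m<j))

        beyond : ∀ i → i < j → m ≤ i ⊎ i < m → Position i (m + (j ∸ m))
        beyond i i<j (inj₁ m≤i) = subst (λ i → Position i (m + (j ∸ m))) (m+[n∸m]≡n m≤i)
          (both-q (∸-monoˡ-< i<j m≤i) j∸m<l)
        beyond zero    _ (inj₂ _)   = start-q j∸m<l
        beyond (suc _) _ (inj₂ i<m) = interior (s≤s z≤n) i<m (m<n⇒0<n∸m m<j) j∸m<l

      distinct< : ∀ {i j} → Position i j → at w i ≢ at w j
      distinct< (both-p i<j j≤m) eq =
        shortest-distinct p p-min i<j j≤m
          (subst₂ _≡_ (at-p (≤-trans (<⇒≤ i<j) j≤m)) (at-p j≤m) eq)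
      distinct< (both-q {i} {j} i<j j<l) eq =
        shortest-distinct q q-min i<j (<⇒≤ j<l) (subst₂ _≡_ (at-q i) (at-q j) eq)
      distinct< (start-q {j} j<l) eq =
        shortest-distinct q q-min j<l ≤-refl
          (subst₂ _≡_ (at-q j) (at-q l) (≡-sym (trans w-closed eq)))
      distinct< (interior 0<i i<m 0<j j<l) eq =
        disjoint (shortest-interior p p-min 0<i i<m) (shortest-interior q q-min 0<j j<l)
          (subst₂ _≡_ (at-p (<⇒≤ i<m)) (at-q _) eq)

      chords< : ∀ {i j} → Position i j → E (at w i) (at w j) →
                suc i ≡ j ⊎ (i ≡ 0 × suc j ≡ m + l)
      chords< (both-p i<j j≤m) e =
        inj₁ (≡-sym (shortest-chordless p p-min i<j j≤m
          (subst₂ E (at-p (≤-trans (<⇒≤ i<j) j≤m)) (at-p j≤m) e , P-p _ , P-p _)))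
      chords< (both-q {i} i<j j<l) e =
        inj₁ (≡-sym (trans (cong (m +_) (shortest-chordless q q-min i<j (<⇒≤ j<l)
          (subst₂ E (at-q _) (at-q _) e , Q-q _ , Q-q _))) (+-suc m i)))
      chords< (start-q {j} j<l) e =
        inj₂ (refl , ≡-sym (trans (cong (m +_) (shortest-chordless q q-min j<l ≤-refl
          (subst₂ E (at-q j) (at-q l) (sym G (subst (λ u → E u (at w (m + j))) (≡-sym w-closed) e)) , Q-q _ , Q-q _)))
          (+-suc m j)))
      chords< (interior 0<i i<m 0<j j<l) e =
        ⊥-elim (separated (shortest-interior p p-min 0<i i<m) (shortest-interior q q-min 0<j j<l)
          (subst₂ E (at-p (<⇒≤ i<m)) (at-q _) e))

      distinct : ∀ (i j : Fin (m + l)) → i ≢ j → _ → at w (toℕ i) ≢ at w (toℕ j)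
      distinct i j i≢j (tri< i<j _ _) = distinct< (position i<j (toℕ<n j))
      distinct i j i≢j (tri≈ _ i≡j _) = contradiction (toℕ-injective i≡j) i≢j
      distinct i j i≢j (tri> _ _ j<i) = distinct< (position j<i (toℕ<n i)) ∘ ≡-sym

      chords : ∀ (i j : Fin (m + l)) → i ≢ j → ¬ CycAdj (m + l) i j →
               E (at w (toℕ i)) (at w (toℕ j)) → _ → ⊥
      chords i j i≢j ¬adj e (tri< i<j _ _) with chords< (position i<j (toℕ<n j)) e
      ... | inj₁ eq = ¬adj (inj₁ eq)
      ... | inj₂ eq = ¬adj (inj₂ (inj₂ (inj₁ eq)))
      chords i j i≢j ¬adj e (tri≈ _ i≡j _) = i≢j (toℕ-injective i≡j)
      chords i j i≢j ¬adj e (tri> _ _ j<i) with chords< (position j<i (toℕ<n i)) (sym G e)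
      ... | inj₁ eq = ¬adj (inj₂ (inj₁ eq))
      ... | inj₂ eq = ¬adj (inj₂ (inj₂ (inj₂ eq)))

      consecutive : ∀ (i : Fin (m + l)) {j} → suc (toℕ i) ≡ j → E (at w (toℕ i)) (at w j)
      consecutive i refl = at-step w (toℕ<n i)

      closing : ∀ {i : ℕ} (j : Fin (m + l)) → i ≡ 0 → suc (toℕ j) ≡ m + l → E (at w (toℕ j)) (at w i)
      closing j refl eq = subst (E _) w-closed (consecutive j eq)

      edges : ∀ i j → CycAdj (m + l) i j → E (at w (toℕ i)) (at w (toℕ j))
      edges i j (inj₁ eq)                      = consecutive i eq
      edges i j (inj₂ (inj₁ eq))               = sym G (consecutive j eq)
      edges i j (inj₂ (inj₂ (inj₁ (i0 , jk)))) = sym G (closing j i0 jk)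
      edges i j (inj₂ (inj₂ (inj₂ (j0 , ik)))) = closing i j0 ik

  -- Disks

  Near : V → V → ℕ → Set
  Near x y r = ∃[ l ] (Walk E x y l × l ≤ r)

  near-refl : ∀ {x r} → Near x x r
  near-refl = 0 , here , z≤n

  near-step : ∀ {x y z r} → E x y → Near y z r → Near x z (suc r)
  near-step e (l , w , l≤r) = suc l , step e w , s≤s l≤r

  near-trans : ∀ {x y z r q} → Near x y r → Near y z q → Near x z (r + q)
  near-trans (k , v , k≤r) (l , w , l≤q) = k + l , v ++ w , +-mono-≤ k≤r l≤q

  near-snoc : ∀ {x y z r} → Near x y r → E y z → Near x z (suc r)
  near-snoc (l , w , l≤r) e = suc l , snoc w e , s≤s l≤r

  near-mono : ∀ {x y r q} → r ≤ q → Near x y r → Near x y q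
  near-mono r≤q (l , w , l≤r) = l , w , ≤-trans l≤r r≤q

  near-sym : ∀ {x y r} → Near x y r → Near y x r
  near-sym (l , w , l≤r) = l , reverse (sym G) w , l≤r

  -- Turns a bound on the distance of two centres into points of the two disks: cut the walk after
  -- `r` steps. A walk that ends by then yields its end twice.
  near-split : ∀ {z w} r {q} → Near z w (suc (r + q)) →
    ∃[ u ] ∃[ u′ ] (Near z u r × (u ≡ u′ ⊎ E u u′) × Near u′ w q)
  near-split r       (_ , here , _)            = _ , _ , near-refl , inj₁ refl , near-refl
  near-split zero    (_ , step e w , s≤s l≤q)  = _ , _ , near-refl , inj₂ e , (_ , w , l≤q)
  near-split (suc r) (_ , step e w , s≤s l≤)   =
    let u , u′ , zu , uu′ , u′w = near-split r (_ , w , l≤)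
    in  u , u′ , near-step e zu , uu′ , u′w

  -- The component and its separator

  module Separator (chordal : IsChordal G) {x y a b} (apart : ¬ Near x y (suc (a + b))) where

    Far : V → Set
    Far u = ¬ Near x u (suc a)

    -- The component, outside the disk of radius a + 1 around x, of the disk D(y,b).
    C : V → Set
    C u = ∃[ l ] Walk (Restrict E Far) y u l

    S : V → Set
    S u = ¬ Far u × ∃[ c ] (C c × E u c)

    y-far : Far y
    y-far xy = apart (near-mono (s≤s (m≤m+n a b)) xy)

    C-start : C y
    C-start = 0 , here

    C⇒Far : ∀ {u} → C u → Far u
    C⇒Far (_ , w) = subst Far (at-end w) (at-Restrict E y-far w _)

    C-boundary : ∀ {c u} → C c → E c u → ¬ ¬ (C u ⊎ S u)
    C-boundary {c} {u} cc@(_ , w) e k = ¬¬-excluded-middle λ where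
      (yes far) → k (inj₁ (_ , snoc w (e , C⇒Far cc , far)))
      (no ¬far) → k (inj₂ (¬far , c , cc , sym G e))

    -- Each vertex of the walk is reached from `y` by extending the walk that puts `u` in `C`.
    C-walk : ∀ {u v l} → C u → Walk (Restrict E Far) u v l → Walk (Restrict E C) u v l
    C-walk cu here = here
    C-walk cu@(_ , v) (step e w) = let cv = _ , snoc v e in step (proj₁ e , cu , cv) (C-walk cv w)

    disk-C-separated : ∀ {u c} → Near x u a → C c → ¬ E u c
    disk-C-separated xu cc e = C⇒Far cc (near-snoc xu e)

    disk-C-disjoint : ∀ {u c} → Near x u a → C c → u ≢ c
    disk-C-disjoint xu cc refl = C⇒Far cc (near-mono (n≤1+n a) xu)

    -- Here `b` bounds the distance covered from `x`. While a step remains, `b + l ≤ suc a` gives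
    -- `b ≤ a`, so only the last vertex can leave the disk.
    through-disk : ∀ {z s b l} → Near x z b → Walk E z s l → b + l ≤ suc a →
      Walk (Restrict E (λ u → u ≡ s ⊎ Near x u a)) z s l
    through-disk xz here _ = here
    through-disk {b = b} xz v@(step {k = k} e w) le =
      step (e , ok xz v le , ok xz′ w le′) (through-disk xz′ w le′)
      where
      xz′ = near-snoc xz e
      le′ = subst (_≤ suc a) (+-suc b k) le
      ok : ∀ {z s b l} → Near x z b → Walk E z s l → b + l ≤ suc a → z ≡ s ⊎ Near x z a
      ok xz here _ = inj₁ refl
      ok {b = b} xz (step {k = k} _ _) le =
        inj₂ (near-mono (≤-trans (m≤m+n b k) (s≤s⁻¹ (subst (_≤ suc a) (+-suc b k) le))) xz)

    S-clique : ∀ {s t} → S s → S t → ¬ ¬ (s ≡ t ⊎ E s t)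
    S-clique {s} {t} (near-s , c , (_ , wc) , sc) (near-t , d , (_ , wd) , td) ¬st =
      near-s λ (_ , ws , ls) → near-t λ (_ , wt , lt) →
      no-two-sided-detour chordal (λ u → Near x u a) C disk-C-disjoint disk-C-separated
        (¬st ∘ inj₁) (¬st ∘ inj₂)
        -- One side: from `s` back to the centre `x`, then on to `t`.
        (mapWalk (widen λ { (inj₁ eq) → inj₁ eq ; (inj₂ d) → inj₂ (inj₂ d) })
           (reverse restrict-sym (through-disk near-refl ws ls))
         ++ mapWalk (widen λ { (inj₁ eq) → inj₂ (inj₁ eq) ; (inj₂ d) → inj₂ (inj₂ d) })
           (through-disk near-refl wt lt))
        -- The other side: from `t` to `d`, through `C` by way of `y` to `c`, then to `s`.
        (step (td , inj₁ refl , inC (_ , wd))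
          (mapWalk (widen inC) (reverse restrict-sym (C-walk C-start wd) ++ C-walk C-start wc)
           ++ step (sym G sc , inC (_ , wc) , inj₂ (inj₁ refl)) here))
      where
      inC : ∀ {u} → C u → Via t s C u
      inC = inj₂ ∘ inj₂
      widen : ∀ {P Q : V → Set} → (∀ {u} → P u → Q u) → ∀ {u v} → Restrict E P u v → Restrict E Q u v
      widen h (e , pu , pv) = e , h pu , h pv
      restrict-sym : ∀ {P : V → Set} {u v} → Restrict E P u v → Restrict E P v u
      restrict-sym (e , pu , pv) = sym G e , pv , pu

    -- Disks that miss the separator

    Misses : V → ℕ → Set
    Misses z r = ∀ {u} → Near z u r → ¬ S u

    -- Testing the centre suffices: a walk within the disk cannot pass between `C` and the rest
    -- without meeting `S`.
    Inside : V → ℕ → Set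
    Inside z r = Misses z r × C z

    Outside : V → ℕ → Set
    Outside z r = Misses z r × ¬ C z

    inside-disk : ∀ {z r u} → Inside z r → Near z u r → ¬ ¬ C u
    inside-disk (miss , cz) (_ , here , _) k = k cz
    inside-disk (miss , cz) (_ , step e w , s≤s l≤r) k = C-boundary cz e λ where
      (inj₁ cz′) → inside-disk ((λ z′u → miss (near-step e z′u)) , cz′) (_ , w , l≤r) k
      (inj₂ sz′) → miss (near-step e near-refl) sz′

    outside-disk : ∀ {z r u} → Outside z r → Near z u r → ¬ C u
    outside-disk (miss , ¬cz) (_ , here , _) = ¬cz
    outside-disk (miss , ¬cz) (_ , step e w , s≤s l≤r) =
      outside-disk ((λ z′u → miss (near-step e z′u)) , λ cz′ → C-boundary cz′ (sym G e) λ where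
        (inj₁ cz) → ¬cz cz
        (inj₂ sz) → miss near-refl sz) (_ , w , l≤r)

    inside-outside-apart : ∀ {z r w q} → Inside z r → Outside w q → ¬ Near z w (suc (r + q))
    inside-outside-apart {r = r} ins out zw with near-split r zw
    ... | u , u′ , zu , inj₁ refl , u′w =
      inside-disk ins zu (outside-disk out (near-sym u′w))
    ... | u , u′ , zu , inj₂ e , u′w = inside-disk ins zu λ cu → C-boundary cu e λ where
      (inj₁ cu′) → outside-disk out (near-sym u′w) cu′
      (inj₂ su′) → proj₁ out (near-sym u′w) su′

    -- Vertices of `C` are at distance at least `a + 2` from `x`, so no vertex of this disk has a
    -- neighbour in `C`.
    x-outside : Outside x a
    x-outside = (λ xu (_ , _ , cc , e) → disk-C-separated xu cc e) , λ cx → C⇒Far cx near-refl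

    -- A vertex of `S` in this disk would give a walk from `x` to `y` of length at most `a + 1 + b`.
    y-inside : Inside y b
    y-inside = (λ yu (¬far , _) → ¬far λ xu →
      apart (near-trans xu (near-sym yu))) , C-start

    inside-or-outside : ∀ {z r} → Misses z r → ¬ ¬ (Inside z r ⊎ Outside z r)
    inside-or-outside miss k = ¬¬-excluded-middle λ where
      (yes cz) → k (inj₁ (miss , cz))
      (no ¬cz) → k (inj₂ (miss , ¬cz))

  -- Families of disks around a hole

  Close : (V → ℕ) → (V → ℕ) → Set
  Close f g = ∀ x y → ¬ ¬ Near x y (suc (f x + g y))

  close-sym : ∀ {f g} → Close f g → Close g f
  close-sym {f} {g} fg x y k = fg y x λ yx →
    k (subst (λ r → Near x y (suc r)) (+-comm (f y) (g x)) (near-sym yx))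

  -- The cycle is F 0, …, F k; values of F beyond k are irrelevant.
  no-close-hole : IsChordal G → (F : ℕ → V → ℕ) (k : ℕ) →
    (∀ j → j < k → Close (F j) (F (suc j))) → Close (F k) (F 0) →
    ¬ Close (F 0) (F 2) → (∀ j → 3 ≤ j → j ≤ k → ¬ Close (F 1) (F j)) → 2 ≤ k → ⊥
  no-close-hole chordal F k consecutive closing ¬02 ¬1j 2≤k =
    ¬02 λ x y apart → around apart
    where
    around : ∀ {x y} → ¬ Near x y (suc (F 0 x + F 2 y)) → ⊥
    -- An inside disk at index `k` contradicts the closing edge, as the disk of `F 0` around `x` is
    -- outside.
    around {x} {y} apart = inside-at (k ∸ 2) (≤-reflexive (m+[n∸m]≡n 2≤k)) λ (z , ins) →
        subst (λ j → Close (F j) (F 0)) (≡-sym (m+[n∸m]≡n 2≤k)) closing z x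
          (inside-outside-apart ins x-outside)
      where
      open Separator chordal {x} {y} {F 0 x} {F 2 y} apart

      F1-meets : ∀ z → ¬ Misses z (F 1 z)
      F1-meets z miss = inside-or-outside miss λ where
        (inj₁ ins) → close-sym {F 0} {F 1} (consecutive 0 (≤-trans (s≤s z≤n) 2≤k)) z x
                       (inside-outside-apart ins x-outside)
        (inj₂ out) → close-sym {F 1} {F 2} (consecutive 1 2≤k) y z (inside-outside-apart y-inside out)

      meets⇒close : ∀ {g} → (∀ z → ¬ Misses z (g z)) → Close (F 1) g
      meets⇒close {g} meets z w k =
        F1-meets z λ zs s → meets w λ wt t → S-clique s t λ where
          (inj₁ refl) → k (near-mono (n≤1+n _) (near-trans zs (near-sym wt)))
          (inj₂ e)    → k (near-mono (≤-reflexive (+-suc (F 1 z) (g w)))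
                             (near-trans zs (near-step e (near-sym wt))))

      -- An inside disk is passed on along the cycle. If all disks of the next function met `S`,
      -- that function would be close to `F 1`; so one misses `S`, and being within distance 1 of
      -- the previous inside disk it cannot be outside.
      inside-at : ∀ i → 2 + i ≤ k → ¬ ¬ (∃[ z ] Inside z (F (2 + i) z))
      inside-at zero    _  found = found (y , y-inside)
      inside-at (suc i) le found = inside-at i (<⇒≤ le) λ (z , ins) →
        ¬1j (3 + i) (s≤s (s≤s (s≤s z≤n))) le (meets⇒close λ w miss →
          inside-or-outside miss λ where
            (inj₁ ins′) → found (w , ins′)
            (inj₂ out)  → consecutive (2 + i) le z w (inside-outside-apart ins out))

  -- Closeness and adjacency in the hull

  open Hull G hiding (V)

  ¬¬-dist : ∀ x y → ¬ ¬ (∃[ d ] IsDist G x y d)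
  ¬¬-dist x y = ¬¬-least _ (connected G x y)

  foldr-⊔-bound : ∀ (h : V → ℕ) {x} xs → x ∈ xs → h x ≤ foldr _⊔_ 0 (map h xs)
  foldr-⊔-bound h (x ∷ xs) (here refl) = m≤m⊔n _ _
  foldr-⊔-bound h (x ∷ xs) (there x∈)  = ≤-trans (foldr-⊔-bound h xs x∈) (m≤n⊔m _ _)

  foldr-⊔-least : ∀ (h : V → ℕ) {b} xs → (∀ x → h x ≤ b) → foldr _⊔_ 0 (map h xs) ≤ b
  foldr-⊔-least h []       le = z≤n
  foldr-⊔-least h (x ∷ xs) le = ⊔-lub (le x) (foldr-⊔-least h xs le)

  supDist-bound : ∀ f g x → ∣ f x - g x ∣ ≤ supDist f g
  supDist-bound f g x = foldr-⊔-bound (λ x → ∣ f x - g x ∣) (allFin (n G)) (∈-allFin x)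

  -- The distance of `x` and `y` is at most `f x + f y`, and `f y` exceeds `g y` by at most 1.
  ~H⇒Close : ∀ {a b} → a ~H b → Close (proj₁ a) (proj₁ b)
  ~H⇒Close {f , f-hull , _} {g , _} f~g x y k = ¬¬-dist x y λ (d , dist) → k (d , proj₁ dist , (begin
    d                            ≤⟨ f-hull x y d dist ⟩
    f x + f y                    ≤⟨ +-monoʳ-≤ (f x) (m≤n+∣m-n∣ (f y) (g y)) ⟩
    f x + (g y + ∣ f y - g y ∣)  ≤⟨ +-monoʳ-≤ (f x) (+-monoʳ-≤ (g y)
                                      (≤-trans (supDist-bound f g y) (≤-reflexive f~g))) ⟩
    f x + (g y + 1)              ≡⟨ cong (f x +_) (+-comm (g y) 1) ⟩
    f x + suc (g y)              ≡⟨ +-suc (f x) (g y) ⟩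
    suc (f x + g y)              ∎))
    where open ≤-Reasoning

  close⇒≤ : ∀ ((f , _) : HVertex) {g} → Close g f → ∀ x → f x ≤ suc (g x)
  close⇒≤ (f , _ , tight) {g} gf x with tight x
  ... | y , d , (_ , d-min) , fx+fy≡d = decidable-stable (f x ≤? suc (g x)) λ ¬le →
    gf x y λ (l , w , l≤) → ¬le (+-cancelʳ-≤ (f y) (f x) (suc (g x))
      (≤-trans (≤-reflexive fx+fy≡d) (≤-trans (d-min l w) l≤)))

  Close⇒≈H⊎~H : ∀ {a b} → Close (proj₁ a) (proj₁ b) → a ≈H b ⊎ a ~H b
  Close⇒≈H⊎~H {a@(f , _)} {b@(g , _)} fg = from-≤1 _ refl
    (foldr-⊔-least _ (allFin (n G)) λ x →
      ∣-∣≤1 (close⇒≤ a {g} (close-sym {f} {g} fg) x) (close⇒≤ b {f} fg x))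
    where
    ∣-∣≤1 : ∀ {p q} → p ≤ suc q → q ≤ suc p → ∣ p - q ∣ ≤ 1
    ∣-∣≤1 {p} {q} p≤ q≤ with ≤-total p q
    ... | inj₁ p≤q = subst (_≤ 1) (≡-sym (m≤n⇒∣m-n∣≡n∸m p≤q))
                       (m≤n+o⇒m∸n≤o q p (≤-trans q≤ (≤-reflexive (+-comm 1 p))))
    ... | inj₂ q≤p = subst (_≤ 1) (≡-sym (m≤n⇒∣n-m∣≡n∸m q≤p))
                       (m≤n+o⇒m∸n≤o p q (≤-trans p≤ (≤-reflexive (+-comm 1 q))))
    from-≤1 : ∀ s → supDist f g ≡ s → s ≤ 1 → a ≈H b ⊎ a ~H b
    from-≤1 zero          eq _ = inj₁ λ x → ∣m-n∣≡0⇒m≡n (n≤0⇒n≡0 (subst (_ ≤_) eq (supDist-bound f g x)))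
    from-≤1 (suc zero)    eq _ = inj₂ eq
    from-≤1 (suc (suc _)) eq (s≤s ())

-- Induced cycles of the hull

theorem3 : (G : Graph) → IsChordal G → HullChordal G
theorem3 G chordal (suc k) (s≤s 3≤k) v cycle = no-close-hole G chordal F k
  (λ j j<k → edge (toℕ-index (<⇒≤ j<k)) (toℕ-index j<k) (inj₁ refl))
  (edge (toℕ-index ≤-refl) (toℕ-index z≤n) (inj₂ (inj₂ (inj₂ (refl , refl)))))
  (non-edge (toℕ-index z≤n) (toℕ-index 2≤k) (λ ()) λ where
    (inj₁ ())
    (inj₂ (inj₁ ()))
    -- The closing edge joins 0 and 2 only in a cycle of length 3.
    (inj₂ (inj₂ (inj₁ (_ , 3≡1+k)))) → <⇒≢ (s≤s 3≤k) 3≡1+k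
    (inj₂ (inj₂ (inj₂ (() , _)))))
  (λ { j 3≤j j≤k → non-edge (toℕ-index (≤-trans (s≤s z≤n) 3≤k)) (toℕ-index j≤k)
    (<⇒≢ (≤-trans (s≤s (s≤s z≤n)) 3≤j)) λ where
    (inj₁ 2≡j) → <⇒≢ 3≤j 2≡j
    (inj₂ (inj₁ 1+j≡1)) → <⇒≢ (≤-trans (s≤s z≤n) 3≤j) (≡-sym (suc-injective 1+j≡1))
    (inj₂ (inj₂ (inj₁ (() , _))))
    (inj₂ (inj₂ (inj₂ (j≡0 , _)))) → <⇒≢ (≤-trans (s≤s z≤n) 3≤j) (≡-sym j≡0) })
  2≤k
  where
  2≤k = <⇒≤ 3≤k

  -- Clipping at `k` makes `F` total; only indices up to `k` are ever compared.
  index : ℕ → Fin (suc k)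
  index j = fromℕ< (s≤s (m⊓n≤n j k))

  toℕ-index : ∀ {j} → j ≤ k → toℕ (index j) ≡ j
  toℕ-index {j} j≤k = trans (toℕ-fromℕ< _) (m≤n⇒m⊓n≡m j≤k)

  F : ℕ → Fin (n G) → ℕ
  F j = proj₁ (v (index j))

  -- `CycAdj (suc k) i j` unfolds to this relation at `toℕ i` and `toℕ j`, so `subst₂` can move it
  -- along equations between numbers.
  ℕCycAdj : ℕ → ℕ → Set
  ℕCycAdj i j = suc i ≡ j ⊎ suc j ≡ i ⊎ (i ≡ 0 × suc j ≡ suc k) ⊎ (j ≡ 0 × suc i ≡ suc k)

  edge : ∀ {i j} → toℕ (index i) ≡ i → toℕ (index j) ≡ j → ℕCycAdj i j → Close G (F i) (F j)
  edge {i} {j} pi pj adj = ~H⇒Close G {v (index i)} {v (index j)}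
    (IsInducedCycle.edges cycle _ _ (subst₂ ℕCycAdj (≡-sym pi) (≡-sym pj) adj))

  non-edge : ∀ {i j} → toℕ (index i) ≡ i → toℕ (index j) ≡ j → i ≢ j → ¬ ℕCycAdj i j →
             ¬ Close G (F i) (F j)
  non-edge {i} {j} pi pj i≢j ¬adj close with Close⇒≈H⊎~H G {v (index i)} {v (index j)} close
  ... | inj₁ eq = IsInducedCycle.distinct cycle _ _
    (λ eq → i≢j (trans (≡-sym pi) (trans (cong toℕ eq) pj))) eq
  ... | inj₂ e  = IsInducedCycle.noChords cycle _ _
    (λ eq → i≢j (trans (≡-sym pi) (trans (cong toℕ eq) pj))) (¬adj ∘ subst₂ ℕCycAdj pi pj) e
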